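{- For every integer $m\geq 2$ and every integer $n\geq 2$, the graph $mB_n$ (the disjoint union of $m$ copies of the book graph $B_n$) is $C_4$-supermagic.
   Context: All graphs are finite and simple. For a graph $H$, a graph $G=(V,E)$ has an $H$-covering if every edge of $G$ belongs to a subgraph of $G$ isomorphic to $H$. For such $G$, an $H$-magic labeling is a bijection $\lambda: V\cup E\to\{1,2,\dots,|V|+|E|\}$ for which there is a constant $c$ such that for every subgraph $H'=(V',E')$ of $G$ isomorphic to $H$, $\sum_{v\in V'}\lambda(v)+\sum_{e\in E'}\lambda(e)=c$. It is $H$-supermagic if moreover $\{\lambda(v):v\in V\}=\{1,\dots,|V|\}$; $G$ is $H$-supermagic if it admits such a labeling. $C_k$ is the cycle of length $k$. $mG$ denotes the disjoint union of $m$ copies of $G$. The book graph $B_n=K_{1,n}\times K_2$ has vertices $u_1,u_2,v_i,w_i$ ($1\le i\le n$) and edges $u_1u_2$, and $u_1w_i$, $u_2v_i$, $v_iw_i$ ($1\le i\le n$). -}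

module Defs where

open import Algebra.Properties.CommutativeMonoid.Sum using (sum)
open import Data.Bool using (Bool; true; false; T)
open import Data.Bool.Properties using (T-irrelevant)
open import Data.Fin using (Fin; zero; suc; toℕ)
open import Data.Fin.Properties using (toℕ<n; toℕ-fromℕ<; 0↔⊥; 1↔⊤; +↔⊎; *↔×)
open import Data.Nat using (ℕ; zero; suc; _+_; _≤_; _≤?_; _%_)
open import Data.Nat.DivMod using (_mod_; m%n<n; m<n⇒m%n≡m; n%n≡0)
open import Data.Nat.Properties using (+-0-commutativeMonoid; m≤n⇒m<n∨m≡n; suc-injective; 1+n≢n; m+1+n≢n)
open import Data.Product using (Σ; ∃; _×_; _,_; proj₁; proj₂; map; swap)
open import Data.Product.Function.NonDependent.Propositional using (_×-↔_)
open import Data.Sum using (_⊎_; inj₁; inj₂)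
open import Data.Sum.Function.Propositional using (_⊎-↔_)
open import Function using (_∘_)
open import Function.Bundles using (_↔_; _⤖_; _⇔_; Inverse; Bijection; mk↔ₛ′)
open import Function.Properties.Inverse using (↔-refl; ↔-sym; ↔-trans)
open import Relation.Binary.PropositionalEquality
  using (_≡_; _≢_; refl; sym; trans; cong; cong₂; subst)
open import Relation.Nullary using (contradiction)
open import Relation.Nullary.Decidable using (True)
open import Relation.Unary using (_≐_)

record Finite (A : Set) : Set where
  field
    card : ℕ
    enum : A ↔ Fin card

  sumOver : (A → ℕ) → ℕ
  sumOver f = sum +-0-commutativeMonoid (f ∘ Inverse.from enum)

open Finite

transport : ∀ {A B} → A ↔ B → Finite B → Finite A
transport A↔B finB = record { enum = ↔-trans A↔B (enum finB) }

finite-Fin : ∀ n → Finite (Fin n)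
finite-Fin n = record { enum = ↔-refl }

finite-⊎ : ∀ {A B} → Finite A → Finite B → Finite (A ⊎ B)
finite-⊎ a b = record { enum = ↔-trans (enum a ⊎-↔ enum b) (↔-sym +↔⊎) }

finite-× : ∀ {A B} → Finite A → Finite B → Finite (A × B)
finite-× a b = record { enum = ↔-trans (enum a ×-↔ enum b) (↔-sym *↔×) }

finite-T : ∀ b → Finite (T b)
finite-T true  = record { enum = ↔-sym 1↔⊤ }
finite-T false = record { enum = ↔-sym 0↔⊥ }

Subtype : {A : Set} → (A → Bool) → Set
Subtype {A} p = Σ A (T ∘ p)

Subtype-≡ : ∀ {A : Set} (p : A → Bool) {x y : Subtype p} →
            proj₁ x ≡ proj₁ y → x ≡ y
Subtype-≡ p {a , s} {.a , t} refl = cong (a ,_) (T-irrelevant s t)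

finite-Subtype-Fin : ∀ n (p : Fin n → Bool) → Finite (Subtype p)
finite-Subtype-Fin zero    p =
  transport (mk↔ₛ′ (λ ()) (λ ()) (λ ()) (λ ())) (finite-Fin 0)
finite-Subtype-Fin (suc n) p =
  transport split (finite-⊎ (finite-T (p zero)) (finite-Subtype-Fin n (p ∘ suc)))
  where
  split : Subtype p ↔ (T (p zero) ⊎ Subtype (p ∘ suc))
  split = mk↔ₛ′
    (λ { (zero , t) → inj₁ t ; (suc i , t) → inj₂ (i , t) })
    (λ { (inj₁ t) → zero , t ; (inj₂ (i , t)) → suc i , t })
    (λ { (inj₁ t) → refl ; (inj₂ (i , t)) → refl })
    (λ { (zero , t) → refl ; (suc i , t) → refl })

finite-Subtype : ∀ {A} → Finite A → (p : A → Bool) → Finite (Subtype p)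
finite-Subtype {A} finA p = transport restrict (finite-Subtype-Fin _ (p ∘ from))
  where
  open Inverse (enum finA)
  restrict : Subtype p ↔ Subtype (p ∘ from)
  restrict = mk↔ₛ′
    (λ (a , t) → to a , subst (T ∘ p) (sym (strictlyInverseʳ a)) t)
    (λ (i , t) → from i , t)
    (λ (i , t) → Subtype-≡ (p ∘ from) (strictlyInverseˡ i))
    (λ (a , t) → Subtype-≡ p (strictlyInverseʳ a))

-- An edge is stored with its two ends in an arbitrary order; `Joins`
-- forgets that order.  By `simple`, E is in bijection with a set of
-- unordered pairs of distinct vertices.
record Graph : Set₁ where
  field
    V E     : Set
    finiteV : Finite V
    finiteE : Finite E
    ends    : E → V × V

  Joins : E → V → V → Set
  Joins e u v = (ends e ≡ (u , v)) ⊎ (ends e ≡ (v , u))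

  field
    loopless : ∀ e → proj₁ (ends e) ≢ proj₂ (ends e)
    simple   : ∀ {e e′ u v} → Joins e u v → Joins e′ u v → e ≡ e′

  Adjacent : V → V → Set
  Adjacent u v = ∃ λ e → Joins e u v

  ∣V∣ ∣E∣ : ℕ
  ∣V∣ = card finiteV
  ∣E∣ = card finiteE

open Graph

infix 4 _≅_

record _≅_ (G H : Graph) : Set where
  field
    onV      : V G ↔ V H
    adjacent : ∀ u v →
      Adjacent G u v ⇔ Adjacent H (Inverse.to onV u) (Inverse.to onV v)

-- Subsets of the finite sets V and E are given by characteristic functions.
record Subgraph (G : Graph) : Set where
  field
    inV    : V G → Bool
    inE    : E G → Bool
    closed : ∀ e → T (inE e) →
             T (inV (proj₁ (ends G e))) × T (inV (proj₂ (ends G e)))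

  graph : Graph
  graph = record
    { V        = Subtype inV
    ; E        = Subtype inE
    ; finiteV  = finite-Subtype (finiteV G) inV
    ; finiteE  = finite-Subtype (finiteE G) inE
    ; ends     = λ (e , t) → (_ , proj₁ (closed e t)) , (_ , proj₂ (closed e t))
    ; loopless = λ (e , _) eq → loopless G e (cong proj₁ eq)
    ; simple   = λ j j′ → Subtype-≡ inE (simple G (forget j) (forget j′))
    }
    where
    under : Subtype inV × Subtype inV → V G × V G
    under = map proj₁ proj₁

    forget : ∀ {p q r} → p ≡ q ⊎ p ≡ r → under p ≡ under q ⊎ under p ≡ under r
    forget (inj₁ eq) = inj₁ (cong under eq)
    forget (inj₂ eq) = inj₂ (cong under eq)

open Subgraph

HasCovering : Graph → Graph → Set
HasCovering H G = ∀ (e : E G) → ∃ λ (S : Subgraph G) → T (inE S e) × graph S ≅ H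

record MagicLabeling (H G : Graph) : Set where
  field
    bijection : (V G ⊎ E G) ⤖ Fin (∣V∣ G + ∣E∣ G)

  -- Fin N is {0,…,N-1}, whereas labels are 1,…,N.
  label : V G ⊎ E G → ℕ
  label x = suc (toℕ (Bijection.to bijection x))

  weight : Subgraph G → ℕ
  weight S = sumOver (finiteV (graph S)) (label ∘ inj₁ ∘ proj₁)
           + sumOver (finiteE (graph S)) (label ∘ inj₂ ∘ proj₁)

  field
    constant : ℕ
    magic    : ∀ (S : Subgraph G) → graph S ≅ H → weight S ≡ constant

IsSupermagic : ∀ {H G} → MagicLabeling H G → Set
IsSupermagic {G = G} L =
  (λ k → ∃ λ v → label (inj₁ v) ≡ k) ≐ (λ k → 1 ≤ k × k ≤ ∣V∣ G)
  where open MagicLabeling L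

_-Supermagic_ : Graph → Graph → Set
H -Supermagic G = HasCovering H G × ∃ λ (L : MagicLabeling H G) → IsSupermagic L

next : ∀ {n} → Fin (suc n) → Fin (suc n)
next {n} i = suc (toℕ i) mod suc n

next-spec : ∀ {n} (i : Fin (suc n)) →
            toℕ (next i) ≡ suc (toℕ i) ⊎ (toℕ i ≡ n × toℕ (next i) ≡ 0)
next-spec {n} i with m≤n⇒m<n∨m≡n (toℕ<n i)
... | inj₁ lt = inj₁ (trans (toℕ-fromℕ< (m%n<n (suc (toℕ i)) (suc n))) (m<n⇒m%n≡m lt))
... | inj₂ eq = inj₂ (suc-injective eq ,
  trans (toℕ-fromℕ< (m%n<n (suc (toℕ i)) (suc n)))
        (trans (cong (λ x → x % suc n) eq) (n%n≡0 (suc n))))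

next-loopless : ∀ {n} (i : Fin (2 + n)) → i ≢ next i
next-loopless i eq with next-spec i
... | inj₁ p = 1+n≢n (trans (sym p) (cong toℕ (sym eq)))
... | inj₂ (p , q) with trans (sym p) (trans (cong toℕ eq) q)
...   | ()

next-simple : ∀ {n} (i j : Fin (3 + n)) → next i ≡ j → next j ≢ i
next-simple i .(next i) refl eq with next-spec i | next-spec (next i)
... | inj₁ p | inj₁ q =
  m+1+n≢n 1 (trans (cong suc (sym p)) (trans (sym q) (cong toℕ eq)))
... | inj₁ p | inj₂ (q , r)
  with trans (sym q) (trans p (cong suc (trans (cong toℕ (sym eq)) r)))
...   | ()
next-simple i .(next i) refl eq | inj₂ (p , q) | inj₁ r
  with trans (sym p) (trans (cong toℕ (sym eq)) (trans r (cong suc q)))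
...   | ()
next-simple i .(next i) refl eq | inj₂ (p , q) | inj₂ (r , s)
  with trans (sym r) q
...   | ()

-- Edge i joins the vertices i and i + 1 (mod k).
C : (k : ℕ) {3≤k : True (3 ≤? k)} → Graph
C (suc (suc (suc j))) = record
  { V        = Fin (3 + j)
  ; E        = Fin (3 + j)
  ; finiteV  = finite-Fin (3 + j)
  ; finiteE  = finite-Fin (3 + j)
  ; ends     = λ i → i , next i
  ; loopless = next-loopless
  ; simple   = simple′
  }
  where
  simple′ : ∀ {i i′ a b : Fin (3 + j)} →
            (i , next i) ≡ (a , b) ⊎ (i , next i) ≡ (b , a) →
            (i′ , next i′) ≡ (a , b) ⊎ (i′ , next i′) ≡ (b , a) → i ≡ i′
  simple′ (inj₁ p) (inj₁ q) = cong proj₁ (trans p (sym q))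
  simple′ (inj₂ p) (inj₂ q) = cong proj₁ (trans p (sym q))
  simple′ {i} {i′} (inj₁ refl) (inj₂ q) =
    contradiction (cong proj₂ q) (next-simple i i′ (sym (cong proj₁ q)))
  simple′ {i} {i′} (inj₂ refl) (inj₁ q) =
    contradiction (cong proj₂ q) (next-simple i i′ (sym (cong proj₁ q)))

infix 8 _copiesOf_

_copiesOf_ : ℕ → Graph → Graph
m copiesOf G = record
  { V        = Fin m × V G
  ; E        = Fin m × E G
  ; finiteV  = finite-× (finite-Fin m) (finiteV G)
  ; finiteE  = finite-× (finite-Fin m) (finiteE G)
  ; ends     = λ (i , e) → (i , proj₁ (ends G e)) , (i , proj₂ (ends G e))
  ; loopless = λ (i , e) eq → loopless G e (cong proj₂ eq)
  ; simple   = simple′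
  }
  where
  copy : Fin m × E G → (Fin m × V G) × (Fin m × V G)
  copy (i , e) = (i , proj₁ (ends G e)) , (i , proj₂ (ends G e))

  forget : ∀ {p q r : (Fin m × V G) × (Fin m × V G)} → p ≡ q ⊎ p ≡ r →
           map proj₂ proj₂ p ≡ map proj₂ proj₂ q ⊎ map proj₂ proj₂ p ≡ map proj₂ proj₂ r
  forget (inj₁ eq) = inj₁ (cong (map proj₂ proj₂) eq)
  forget (inj₂ eq) = inj₂ (cong (map proj₂ proj₂) eq)

  index : ∀ {x a b} → copy x ≡ (a , b) ⊎ copy x ≡ (b , a) → proj₁ x ≡ proj₁ a
  index (inj₁ eq) = cong (proj₁ ∘ proj₁) eq
  index (inj₂ eq) = cong (proj₁ ∘ proj₂) eq

  simple′ : ∀ {x y a b} → copy x ≡ (a , b) ⊎ copy x ≡ (b , a) →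
            copy y ≡ (a , b) ⊎ copy y ≡ (b , a) → x ≡ y
  simple′ p q = cong₂ _,_ (trans (index p) (sym (index q))) (simple G (forget p) (forget q))

data BookV (n : ℕ) : Set where
  u₁ u₂ : BookV n
  v w   : Fin n → BookV n

data BookE (n : ℕ) : Set where
  u₁u₂       : BookE n
  u₁w u₂v vw : Fin n → BookE n

finite-BookV : ∀ n → Finite (BookV n)
finite-BookV n = transport
  (mk↔ₛ′
    (λ { u₁ → inj₁ zero ; u₂ → inj₁ (suc zero)
       ; (v i) → inj₂ (inj₁ i) ; (w i) → inj₂ (inj₂ i) })
    (λ { (inj₁ zero) → u₁ ; (inj₁ (suc zero)) → u₂
       ; (inj₂ (inj₁ i)) → v i ; (inj₂ (inj₂ i)) → w i })
    (λ { (inj₁ zero) → refl ; (inj₁ (suc zero)) → refl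
       ; (inj₂ (inj₁ i)) → refl ; (inj₂ (inj₂ i)) → refl })
    (λ { u₁ → refl ; u₂ → refl ; (v i) → refl ; (w i) → refl }))
  (finite-⊎ (finite-Fin 2) (finite-⊎ (finite-Fin n) (finite-Fin n)))

finite-BookE : ∀ n → Finite (BookE n)
finite-BookE n = transport
  (mk↔ₛ′
    (λ { u₁u₂ → inj₁ zero ; (u₁w i) → inj₂ (inj₁ i)
       ; (u₂v i) → inj₂ (inj₂ (inj₁ i)) ; (vw i) → inj₂ (inj₂ (inj₂ i)) })
    (λ { (inj₁ zero) → u₁u₂ ; (inj₂ (inj₁ i)) → u₁w i
       ; (inj₂ (inj₂ (inj₁ i))) → u₂v i ; (inj₂ (inj₂ (inj₂ i))) → vw i })
    (λ { (inj₁ zero) → refl ; (inj₂ (inj₁ i)) → refl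
       ; (inj₂ (inj₂ (inj₁ i))) → refl ; (inj₂ (inj₂ (inj₂ i))) → refl })
    (λ { u₁u₂ → refl ; (u₁w i) → refl ; (u₂v i) → refl ; (vw i) → refl }))
  (finite-⊎ (finite-Fin 1) (finite-⊎ (finite-Fin n) (finite-⊎ (finite-Fin n) (finite-Fin n))))

bookEnds : ∀ {n} → BookE n → BookV n × BookV n
bookEnds u₁u₂    = u₁ , u₂
bookEnds (u₁w i) = u₁ , w i
bookEnds (u₂v i) = u₂ , v i
bookEnds (vw i)  = v i , w i

B : ℕ → Graph
B n = record
  { V        = BookV n
  ; E        = BookE n
  ; finiteV  = finite-BookV n
  ; finiteE  = finite-BookE n
  ; ends     = bookEnds
  ; loopless = λ { u₁u₂ () ; (u₁w _) () ; (u₂v _) () ; (vw _) () }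
  ; simple   = simple′
  }
  where
  parallel : ∀ (e e′ : BookE n) → bookEnds e ≡ bookEnds e′ → e ≡ e′
  parallel u₁u₂    u₁u₂    refl = refl
  parallel (u₁w _) (u₁w _) refl = refl
  parallel (u₂v _) (u₂v _) refl = refl
  parallel (vw _)  (vw _)  refl = refl

  antiparallel : ∀ (e e′ : BookE n) → bookEnds e ≢ swap (bookEnds e′)
  antiparallel u₁u₂    u₁u₂    ()
  antiparallel u₁u₂    (u₁w _) ()
  antiparallel u₁u₂    (u₂v _) ()
  antiparallel u₁u₂    (vw _)  ()
  antiparallel (u₁w _) u₁u₂    ()
  antiparallel (u₁w _) (u₁w _) ()
  antiparallel (u₁w _) (u₂v _) ()
  antiparallel (u₁w _) (vw _)  ()
  antiparallel (u₂v _) u₁u₂    ()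
  antiparallel (u₂v _) (u₁w _) ()
  antiparallel (u₂v _) (u₂v _) ()
  antiparallel (u₂v _) (vw _)  ()
  antiparallel (vw _)  u₁u₂    ()
  antiparallel (vw _)  (u₁w _) ()
  antiparallel (vw _)  (u₂v _) ()
  antiparallel (vw _)  (vw _)  ()

  simple′ : ∀ {e e′ a b} →
            bookEnds e ≡ (a , b) ⊎ bookEnds e ≡ (b , a) →
            bookEnds e′ ≡ (a , b) ⊎ bookEnds e′ ≡ (b , a) → e ≡ e′
  simple′ (inj₁ p) (inj₁ q) = parallel _ _ (trans p (sym q))
  simple′ (inj₂ p) (inj₂ q) = parallel _ _ (trans p (sym q))
  simple′ {e} {e′} (inj₁ p) (inj₂ q) =
    contradiction (trans p (cong swap (sym q))) (antiparallel e e′)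
  simple′ {e} {e′} (inj₂ p) (inj₁ q) =
    contradiction (trans p (cong swap (sym q))) (antiparallel e e′)

{-# OPTIONS --safe #-}

-- The 4-cycles of B n are exactly its n pages, so only the page sums matter.  In copy k
-- the vertex x gets the label 1 + m ρ(x) + k, where ρ is the standard enumeration of the
-- vertices of B n; page i then has vertex sum const + 2 m i + 4 k.  The edges are labelled
-- in the same way by an enumeration ρ′ with page sums r + 2 i, but read backwards, which
-- turns their contribution into const - 2 m i - 4 k.  For ρ′ the four edges of page i are
-- the common spine, whose rank is constant, an edge vw of rank const + i, and two edges of
-- ranks α i and β i, namely α (2j) = j, β (2j) = b + j, α (2j + 1) = c + j and
-- β (2j + 1) = d + j, with c + d = b + 1.  For odd n these ranks fill two intervals; for
-- even n those of α leave one gap in the middle, which the spine fills.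
module Submission where

open import Defs
open import Algebra.Properties.CommutativeMonoid.Sum using (sum-permute; sum-cong-≗)
open import Data.Bool using (T)
open import Data.Fin using (Fin; zero; suc; toℕ; fromℕ<)
open import Data.Fin.Patterns using (0F; 1F; 2F; 3F)
open import Data.Fin.Permutation using (↔⇒≡; cast-id; reverse)
open import Data.Fin.Properties
  using (any?; _≟_; toℕ<n; toℕ-fromℕ<; toℕ-cast; toℕ-↑ˡ; toℕ-↑ʳ; toℕ-combine; opposite-prop)
open import Data.Nat using (ℕ; zero; suc; _+_; _*_; _∸_; _≤_; z≤n; s≤s; ⌊_/2⌋; ⌈_/2⌉)
open import Data.Nat.Properties
  using (+-0-commutativeMonoid; +-cancelʳ-≡; m∸n+n≡m; m+n∸n≡m; +-suc)
open import Data.Nat.Tactic.RingSolver using (solve-∀)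
open import Data.Product using (∃; ∃₂; _×_; _,_; proj₁; proj₂; swap)
open import Data.Sum as Sum using (_⊎_; inj₁; inj₂; [_,_])
open import Data.Sum.Function.Propositional using (_⊎-↔_)
open import Data.Sum.Properties using (swap-involutive)
open import Function using (_∘_)
open import Function.Bundles
  using (_↔_; Inverse; Injection; Equivalence; mk↔ₛ′; mk⇔)
open import Function.Properties.Inverse using (↔-refl; ↔-sym; ↔-trans; ↔⇒⤖; ↔⇒↣)
open import Relation.Binary.PropositionalEquality
  using (_≡_; _≢_; refl; sym; trans; cong; cong₂; subst; subst₂; module ≡-Reasoning)
open import Relation.Nullary using (Dec; contradiction)
open import Relation.Nullary.Decidable using (isYes; toWitness; fromWitness; via-injection; True)

open Finite
open Graph
open Subgraph

-- Ranks in enumerated finite sets, and sums over them.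

rank : ∀ {A} → Finite A → A → ℕ
rank F x = toℕ (Inverse.to (enum F) x)

rank-inj₁ : ∀ {A B} (F : Finite A) (G : Finite B) x {k} →
            rank F x ≡ k → rank (finite-⊎ F G) (inj₁ x) ≡ k
rank-inj₁ F G x = trans (toℕ-↑ˡ (Inverse.to (enum F) x) (card G))

rank-inj₂ : ∀ {A B} (F : Finite A) (G : Finite B) y {k} →
            rank G y ≡ k → rank (finite-⊎ F G) (inj₂ y) ≡ card F + k
rank-inj₂ F G y eq =
  trans (toℕ-↑ʳ (card F) (Inverse.to (enum G) y)) (cong (card F +_) eq)

rank-× : ∀ {A B} (F : Finite A) (G : Finite B) x y →
         rank (finite-× F G) (x , y) ≡ card G * rank F x + rank G y
rank-× F G x y = toℕ-combine (Inverse.to (enum F) x) (Inverse.to (enum G) y)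

-- `card (recount F G)` is `card F` by computation, while the ranks are those of G.
recount : ∀ {A} → Finite A → Finite A → Finite A
recount F G = record
  { card = card F
  ; enum = ↔-trans (enum G) (cast-id (↔⇒≡ (↔-trans (↔-sym (enum G)) (enum F))))
  }

rank-recount : ∀ {A} (F G : Finite A) x → rank (recount F G) x ≡ rank G x
rank-recount F G x = toℕ-cast _ (Inverse.to (enum G) x)

reversed : ∀ {A} → Finite A → Finite A
reversed F = record { enum = ↔-trans (enum F) reverse }

-- Reversal sends rank r to `card F` - 1 - r. The additive form spares later proofs the truncated
-- subtraction.
rank-reversed : ∀ {A} (F : Finite A) x → rank (reversed F) x + suc (rank F x) ≡ card F
rank-reversed F x = trans
  (cong (_+ suc (rank F x)) (opposite-prop (Inverse.to (enum F) x)))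
  (m∸n+n≡m (toℕ<n (Inverse.to (enum F) x)))

sumOver-cong : ∀ {A} (F : Finite A) {f g : A → ℕ} → (∀ x → f x ≡ g x) →
               sumOver F f ≡ sumOver F g
sumOver-cong F f≗g = sum-cong-≗ +-0-commutativeMonoid (f≗g ∘ Inverse.from (enum F))

-- Conjugating `φ` by the two enumerations gives a bijection between the index sets, and a finite
-- sum is invariant under permutation.
sumOver-↔ : ∀ {A B} (F : Finite A) (G : Finite B) (φ : A ↔ B) (f : B → ℕ) →
            sumOver F (f ∘ Inverse.to φ) ≡ sumOver G f
sumOver-↔ F G φ f = sym (trans
  (sum-permute +-0-commutativeMonoid (f ∘ Inverse.from (enum G))
    (↔-trans (↔-sym (enum F)) (↔-trans φ (enum G))))
  (sum-cong-≗ +-0-commutativeMonoid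
    (λ i → cong f (Inverse.strictlyInverseʳ (enum G) (Inverse.to φ (Inverse.from (enum F) i))))))

-- Graph embeddings, their ranges, and a criterion for supermagic labelings.

infix 4 _↪_

-- Injectivity is demanded on vertices only: two edges with the same image have the same ends, so
-- simplicity of `H` makes them equal. The image need not be an induced subgraph.
record _↪_ (H G : Graph) : Set where
  field
    onV       : V H → V G
    onE       : E H → E G
    injective : ∀ {x y} → onV x ≡ onV y → x ≡ y
    joins     : ∀ {e x y} → Joins H e x y → Joins G (onE e) (onV x) (onV y)

open _↪_

weightAlong : ∀ {H G} → H ↪ G → (V G → ℕ) → (E G → ℕ) → ℕ
weightAlong {H} φ f g = sumOver (finiteV H) (f ∘ onV φ) + sumOver (finiteE H) (g ∘ onE φ)

module _ {G H : Graph} (I : G ≅ H) where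
  open _≅_ I renaming (onV to σ)

  ≅-sym : H ≅ G
  ≅-sym = record
    { onV      = ↔-sym σ
    ; adjacent = λ x y →
        let open Equivalence (adjacent (Inverse.from σ x) (Inverse.from σ y))
            x≡ = Inverse.strictlyInverseˡ σ x
            y≡ = Inverse.strictlyInverseˡ σ y
        in mk⇔ (λ a → from (subst₂ (Adjacent H) (sym x≡) (sym y≡) a))
               (λ a → subst₂ (Adjacent H) x≡ y≡ (to a))
    }

  -- An isomorphism carries no edge map; the edge that witnesses the adjacency of the two image ends
  -- supplies one.
  ≅⇒↪ : G ↪ H
  ≅⇒↪ = record
    { onV       = Inverse.to σ
    ; onE       = proj₁ ∘ image
    ; injective = Injection.injective (↔⇒↣ σ)
    ; joins     = λ { {e} (inj₁ refl) → proj₂ (image e)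
                    ; {e} (inj₂ refl) → Sum.swap (proj₂ (image e)) }
    }
    where
    image : ∀ e → Adjacent H (Inverse.to σ (proj₁ (ends G e))) (Inverse.to σ (proj₂ (ends G e)))
    image e = Equivalence.to (adjacent _ _) (e , inj₁ refl)

-- A round trip returns an edge with the same two ends, and simplicity identifies it with the
-- original.
≅⇒E↔ : ∀ {G H} → G ≅ H → E G ↔ E H
≅⇒E↔ {G} {H} I = mk↔ₛ′ (onE there) (onE back)
  (λ e → simple H (subst₂ (Joins H _) (strictlyInverseˡ _) (strictlyInverseˡ _)
                    (joins there (joins back (inj₁ refl))))
                  (inj₁ refl))
  (λ e → simple G (subst₂ (Joins G _) (strictlyInverseʳ _) (strictlyInverseʳ _)
                    (joins back (joins there (inj₁ refl))))
                  (inj₁ refl))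
  where
  open Inverse (_≅_.onV I)
  there = ≅⇒↪ I
  back  = ≅⇒↪ (≅-sym I)

inclusion : ∀ {G} (S : Subgraph G) → graph S ↪ G
inclusion {G} S = record
  { onV       = proj₁
  ; onE       = proj₁
  ; injective = Subtype-≡ (inV S)
  ; joins     = λ { (inj₁ refl) → inj₁ refl ; (inj₂ refl) → inj₂ refl }
  }

infixr 9 _∘↪_

_∘↪_ : ∀ {F G H} → G ↪ H → F ↪ G → F ↪ H
ψ ∘↪ φ = record
  { onV       = onV ψ ∘ onV φ
  ; onE       = onE ψ ∘ onE φ
  ; injective = injective φ ∘ injective ψ
  ; joins     = joins ψ ∘ joins φ
  }

parametrize : ∀ {G H} (S : Subgraph G) → graph S ≅ H → H ↪ G
parametrize S I = inclusion S ∘↪ ≅⇒↪ (≅-sym I)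

-- Moves the weight from the subtypes of vertices and edges in `S` to the fixed index sets of `H`;
-- for a cycle these are initial segments of the naturals.
weightAlong-parametrize : ∀ {G H} (S : Subgraph G) (I : graph S ≅ H) f g →
  sumOver (finiteV (graph S)) (f ∘ proj₁) + sumOver (finiteE (graph S)) (g ∘ proj₁)
    ≡ weightAlong (parametrize S I) f g
weightAlong-parametrize {G} {H} S I f g = sym (cong₂ _+_
  (sumOver-↔ (finiteV H) (finiteV (graph S)) (↔-sym (_≅_.onV I)) (f ∘ proj₁))
  (sumOver-↔ (finiteE H) (finiteE (graph S)) (↔-sym (≅⇒E↔ I)) (g ∘ proj₁)))

module _ {A B : Set} (F : Finite A) (G : Finite B) (f : A → B) where

  -- Subgraphs are Boolean characteristic functions, so membership in an image has to be decided,
  -- here by search through the finite domain.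
  image? : ∀ y → Dec (∃ λ i → f (Inverse.from (enum F) i) ≡ y)
  image? y = any? λ i → via-injection (↔⇒↣ (enum G)) _≟_ (f (Inverse.from (enum F) i)) y

  in-image : ∀ x → True (image? (f x))
  in-image x = fromWitness (Inverse.to (enum F) x , cong f (Inverse.strictlyInverseʳ (enum F) x))

  preimage : ∀ {y} → True (image? y) → ∃ λ x → f x ≡ y
  preimage t = let i , eq = toWitness t in Inverse.from (enum F) i , eq

module _ {H G : Graph} (φ : H ↪ G) where
  private
    V? = image? (finiteV H) (finiteV G) (onV φ)
    E? = image? (finiteE H) (finiteE G) (onE φ)

    vertex : ∀ x → T (isYes (V? (onV φ x)))
    vertex = in-image (finiteV H) (finiteV G) (onV φ)

  range : Subgraph G
  range = record
    { inV    = isYes ∘ V?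
    ; inE    = isYes ∘ E?
    ; closed = closed′
    }
    where
    closed′ : ∀ e → True (E? e) → True (V? (proj₁ (ends G e))) × True (V? (proj₂ (ends G e)))
    closed′ e t with preimage (finiteE H) (finiteE G) (onE φ) t
    ... | e′ , refl with joins φ {e′} (inj₁ refl)
    ...   | inj₁ eq rewrite eq = vertex _ , vertex _
    ...   | inj₂ eq rewrite eq = vertex _ , vertex _

  edge-in-range : ∀ e → T (inE range (onE φ e))
  edge-in-range = in-image (finiteE H) (finiteE G) (onE φ)

  -- Injectivity makes `onV φ` a bijection onto the vertices of the range. Every edge of the range
  -- comes from an edge of `H`, so no adjacency is added.
  range≅ : graph range ≅ H
  range≅ = ≅-sym (record { onV = V↔ ; adjacent = λ x y → mk⇔ to′ (from′ x y) })
    where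
    to′ : ∀ {x y} → Adjacent H x y →
          Adjacent (graph range) (onV φ x , vertex x) (onV φ y , vertex y)
    to′ (e , j) = (onE φ e , edge-in-range e) , lift (joins φ j)
      where
      lift : ∀ {e x y s t u} → Joins G e x y → Joins (graph range) (e , s) (x , t) (y , u)
      lift (inj₁ refl) = inj₁ (cong₂ _,_ (Subtype-≡ _ refl) (Subtype-≡ _ refl))
      lift (inj₂ refl) = inj₂ (cong₂ _,_ (Subtype-≡ _ refl) (Subtype-≡ _ refl))

    reflect : ∀ {e x y p q} → Joins H e p q → (onV φ p , onV φ q) ≡ (onV φ x , onV φ y) →
              Joins H e x y
    reflect j eq = subst₂ (Joins H _) (injective φ (cong proj₁ eq)) (injective φ (cong proj₂ eq)) j

    -- `j` and `k` both describe the ends of the same image edge, each in one of two orders;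
    -- cancelling `onV φ` transfers the agreement to `H`.
    match : ∀ {e x y p q} → Joins H e p q → Joins G (onE φ e) (onV φ x) (onV φ y) →
            Joins H e x y
    match j k with joins φ j | k
    ... | inj₁ a | inj₁ b = reflect j (trans (sym a) b)
    ... | inj₂ a | inj₂ b = reflect j (cong swap (trans (sym a) b))
    ... | inj₁ a | inj₂ b = Sum.swap (reflect j (trans (sym a) b))
    ... | inj₂ a | inj₁ b = Sum.swap (reflect j (cong swap (trans (sym a) b)))

    from′ : ∀ x y → Adjacent (graph range) (onV φ x , vertex x) (onV φ y , vertex y) →
            Adjacent H x y
    from′ x y (e , j) with preimage (finiteE H) (finiteE G) (onE φ) (proj₂ e)
                         | joins (inclusion range) {e} j
    ... | e′ , refl | k = e′ , match (inj₁ refl) k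

    V↔ : V H ↔ Subtype (inV range)
    V↔ = mk↔ₛ′ (λ x → onV φ x , vertex x) (proj₁ ∘ pre)
      (λ y → Subtype-≡ (inV range) (proj₂ (pre y)))
      (λ x → injective φ (proj₂ (pre (onV φ x , vertex x))))
      where
      pre : (y : Subtype (inV range)) → ∃ λ x → onV φ x ≡ proj₁ y
      pre (y , t) = preimage (finiteV H) (finiteV G) (onV φ) t

-- Ranges of embeddings are subgraphs isomorphic to `H`, and each such subgraph is parametrized by
-- an embedding, so both conditions can be stated for embeddings. Shifting the edge ranks by `∣V∣ G`
-- leaves the smallest labels to the vertices.
supermagic-from-ranks : ∀ {H G} (F : Finite (V G)) (F′ : Finite (E G)) {c} →
  (∀ e → ∃ λ (φ : H ↪ G) → ∃ λ e′ → onE φ e′ ≡ e) →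
  (∀ (φ : H ↪ G) → weightAlong φ (suc ∘ rank F) (λ e → suc (∣V∣ G + rank F′ e)) ≡ c) →
  H -Supermagic G
supermagic-from-ranks {H} {G} F F′ {c} covered constant-weight =
  cover , L , ranges
  where
  RV = recount (finiteV G) F
  RE = recount (finiteE G) F′

  cover : HasCovering H G
  cover e with covered e
  ... | φ , e′ , refl = range φ , edge-in-range φ e′ , range≅ φ

  labelV : ∀ x → suc (rank (finite-⊎ RV RE) (inj₁ x)) ≡ suc (rank F x)
  labelV x = cong suc (rank-inj₁ RV RE x (rank-recount (finiteV G) F x))

  labelE : ∀ e → suc (rank (finite-⊎ RV RE) (inj₂ e)) ≡ suc (∣V∣ G + rank F′ e)
  labelE e = cong suc (rank-inj₂ RV RE e (rank-recount (finiteE G) F′ e))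

  L : MagicLabeling H G
  L = record
    { bijection = ↔⇒⤖ (enum (finite-⊎ RV RE))
    ; constant  = c
    ; magic     = λ S I → trans
        (cong₂ _+_ (sumOver-cong (finiteV (graph S)) (labelV ∘ proj₁))
                   (sumOver-cong (finiteE (graph S)) (labelE ∘ proj₁)))
        (trans (weightAlong-parametrize S I (suc ∘ rank F) (λ e → suc (∣V∣ G + rank F′ e)))
               (constant-weight (parametrize S I)))
    }

  rankV : ∀ x → rank (finite-⊎ RV RE) (inj₁ x) ≡ rank RV x
  rankV x = rank-inj₁ RV RE x refl

  ranges : IsSupermagic L
  ranges =
    (λ { (x , refl) → s≤s z≤n ,
           subst (_≤ ∣V∣ G) (cong suc (sym (rankV x))) (toℕ<n (Inverse.to (enum RV) x)) }) ,
    -- The label `suc k` belongs to the vertex of rank `k`, and `lt` says that `k` is below `∣V∣ G`.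
    (λ { {suc k} (_ , lt) → Inverse.from (enum RV) (fromℕ< lt)
       , cong suc (trans (rankV _)
           (trans (cong toℕ (Inverse.strictlyInverseˡ (enum RV) (fromℕ< lt))) (toℕ-fromℕ< lt))) })

-- The 4-cycles in copies of a book.

lower : ∀ {m G} {e : E (m copiesOf G)} {x y} → Joins (m copiesOf G) e x y →
        proj₁ x ≡ proj₁ e × proj₁ y ≡ proj₁ e × Joins G (proj₂ e) (proj₂ x) (proj₂ y)
lower (inj₁ refl) = refl , refl , inj₁ refl
lower (inj₂ refl) = refl , refl , inj₂ refl

copy-inclusion : ∀ {m G} → Fin m → G ↪ m copiesOf G
copy-inclusion k = record
  { onV       = k ,_
  ; onE       = k ,_
  ; injective = cong proj₂
  ; joins     = λ { (inj₁ refl) → inj₁ refl ; (inj₂ refl) → inj₂ refl }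
  }

-- Oriented edges, indexed by the edge and both ends, so that matching on consecutive steps
-- enumerates the walks in the book.
data Step {n : ℕ} : BookE n → BookV n → BookV n → Set where
  u₁→u₂ : Step u₁u₂ u₁ u₂
  u₂→u₁ : Step u₁u₂ u₂ u₁
  u₁→w  : ∀ i → Step (u₁w i) u₁ (w i)
  w→u₁  : ∀ i → Step (u₁w i) (w i) u₁
  u₂→v  : ∀ i → Step (u₂v i) u₂ (v i)
  v→u₂  : ∀ i → Step (u₂v i) (v i) u₂
  v→w   : ∀ i → Step (vw i) (v i) (w i)
  w→v   : ∀ i → Step (vw i) (w i) (v i)

step : ∀ {n} e {x y} → Joins (B n) e x y → Step e x y
step u₁u₂    (inj₁ refl) = u₁→u₂
step u₁u₂    (inj₂ refl) = u₂→u₁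
step (u₁w i) (inj₁ refl) = u₁→w i
step (u₁w i) (inj₂ refl) = w→u₁ i
step (u₂v i) (inj₁ refl) = u₂→v i
step (u₂v i) (inj₂ refl) = v→u₂ i
step (vw i)  (inj₁ refl) = v→w i
step (vw i)  (inj₂ refl) = w→v i

Tour : Set
Tour = (ℕ × ℕ × ℕ × ℕ) × (ℕ × ℕ × ℕ × ℕ)

-- The trailing zeros reproduce the computed form of `sumOver (finite-Fin 4)`.
total : Tour → ℕ
total ((a , b , c , d) , (p , q , r , s)) =
  (a + (b + (c + (d + 0)))) + (p + (q + (r + (s + 0))))

rotate : ℕ → Tour → Tour
rotate zero    t = t
rotate (suc k) t = let (a , b , c , d) , (p , q , r , s) = rotate k t in
  (b , c , d , a) , (q , r , s , p)

total-rotate : ∀ k t → total (rotate k t) ≡ total t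
total-rotate zero    t = refl
total-rotate (suc k) t = let (a , b , c , d) , (p , q , r , s) = rotate k t in
  trans (one a b c d p q r s) (total-rotate k t)
  where
  one : ∀ a b c d p q r s →
    (b + (c + (d + (a + 0)))) + (q + (r + (s + (p + 0))))
      ≡ (a + (b + (c + (d + 0)))) + (p + (q + (r + (s + 0))))
  one = solve-∀

-- The first vertex stays in place while the direction turns, so the former closing edge `s` comes
-- first.
mirror : Tour → Tour
mirror ((a , b , c , d) , (p , q , r , s)) = (a , d , c , b) , (s , r , q , p)

total-mirror : ∀ t → total (mirror t) ≡ total t
total-mirror ((a , b , c , d) , (p , q , r , s)) = unfolded a b c d p q r s
  where
  unfolded : ∀ a b c d p q r s →
    (a + (d + (c + (b + 0)))) + (s + (r + (q + (p + 0))))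
      ≡ (a + (b + (c + (d + 0)))) + (p + (q + (r + (s + 0))))
  unfolded = solve-∀

module _ {n : ℕ} (f : BookV n → ℕ) (g : BookE n → ℕ) where

  pageTour : Fin n → Tour
  pageTour i = (f u₁ , f u₂ , f (v i) , f (w i)) , (g u₁u₂ , g (u₂v i) , g (vw i) , g (u₁w i))

  forwards : ∀ k i → total (rotate k (pageTour i)) ≡ total (pageTour i)
  forwards k i = total-rotate k (pageTour i)

  backwards : ∀ k i → total (rotate k (mirror (pageTour i))) ≡ total (pageTour i)
  backwards k i = trans (total-rotate k (mirror (pageTour i))) (total-mirror (pageTour i))

  -- The two inequalities exclude backtracking. A closed walk of length four without it goes once
  -- round a single page, from one of four starting points in one of two directions. The eight
  -- surviving cases are rotations of `pageTour i` or of its mirror image.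
  4-cycle-is-page : ∀ {x₀ x₁ x₂ x₃ e₀ e₁ e₂ e₃} →
    Step e₀ x₀ x₁ → Step e₁ x₁ x₂ → Step e₂ x₂ x₃ → Step e₃ x₃ x₀ → x₀ ≢ x₂ → x₁ ≢ x₃ →
    ∃ λ i → total ((f x₀ , f x₁ , f x₂ , f x₃) , (g e₀ , g e₁ , g e₂ , g e₃)) ≡ total (pageTour i)
  4-cycle-is-page u₁→u₂ u₂→u₁ _ _ x₀≢x₂ _ = contradiction refl x₀≢x₂
  4-cycle-is-page u₁→u₂ (u₂→v i) (v→u₂ i) _ _ x₁≢x₃ = contradiction refl x₁≢x₃
  4-cycle-is-page u₁→u₂ (u₂→v i) (v→w i) (w→u₁ i) _ _ = i , forwards 0 i
  4-cycle-is-page (u₁→w i) (w→u₁ i) _ _ x₀≢x₂ _ = contradiction refl x₀≢x₂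
  4-cycle-is-page (u₁→w i) (w→v i) (v→w i) _ _ x₁≢x₃ = contradiction refl x₁≢x₃
  4-cycle-is-page (u₁→w i) (w→v i) (v→u₂ i) u₂→u₁ _ _ = i , backwards 0 i
  4-cycle-is-page u₂→u₁ u₁→u₂ _ _ x₀≢x₂ _ = contradiction refl x₀≢x₂
  4-cycle-is-page u₂→u₁ (u₁→w i) (w→u₁ i) _ _ x₁≢x₃ = contradiction refl x₁≢x₃
  4-cycle-is-page u₂→u₁ (u₁→w i) (w→v i) (v→u₂ i) _ _ = i , backwards 3 i
  4-cycle-is-page (u₂→v i) (v→u₂ i) _ _ x₀≢x₂ _ = contradiction refl x₀≢x₂
  4-cycle-is-page (u₂→v i) (v→w i) (w→v i) _ _ x₁≢x₃ = contradiction refl x₁≢x₃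
  4-cycle-is-page (u₂→v i) (v→w i) (w→u₁ i) u₁→u₂ _ _ = i , forwards 1 i
  4-cycle-is-page (v→u₂ i) (u₂→v j) (v→u₂ j) _ _ x₁≢x₃ = contradiction refl x₁≢x₃
  4-cycle-is-page (v→u₂ i) (u₂→v i) (v→w i) (w→v i) x₀≢x₂ _ = contradiction refl x₀≢x₂
  4-cycle-is-page (v→u₂ i) u₂→u₁ u₁→u₂ _ _ x₁≢x₃ = contradiction refl x₁≢x₃
  4-cycle-is-page (v→u₂ i) u₂→u₁ (u₁→w i) (w→v i) _ _ = i , backwards 2 i
  4-cycle-is-page (v→w i) (w→v i) _ _ x₀≢x₂ _ = contradiction refl x₀≢x₂
  4-cycle-is-page (v→w i) (w→u₁ i) (u₁→w i) (w→v i) _ x₁≢x₃ = contradiction refl x₁≢x₃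
  4-cycle-is-page (v→w i) (w→u₁ i) u₁→u₂ (u₂→v i) _ _ = i , forwards 2 i
  4-cycle-is-page (w→u₁ i) (u₁→w j) (w→u₁ j) _ _ x₁≢x₃ = contradiction refl x₁≢x₃
  4-cycle-is-page (w→u₁ i) (u₁→w i) (w→v i) (v→w i) x₀≢x₂ _ = contradiction refl x₀≢x₂
  4-cycle-is-page (w→u₁ i) u₁→u₂ u₂→u₁ _ _ x₁≢x₃ = contradiction refl x₁≢x₃
  4-cycle-is-page (w→u₁ i) u₁→u₂ (u₂→v i) (v→w i) _ _ = i , forwards 3 i
  4-cycle-is-page (w→v i) (v→w i) _ _ x₀≢x₂ _ = contradiction refl x₀≢x₂
  4-cycle-is-page (w→v i) (v→u₂ i) (u₂→v i) (v→w i) _ x₁≢x₃ = contradiction refl x₁≢x₃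
  4-cycle-is-page (w→v i) (v→u₂ i) u₂→u₁ (u₁→w i) _ _ = i , backwards 1 i

page : ∀ {n} → Fin n → C 4 ↪ B n
page {n} i = record
  { onV       = vertex
  ; onE       = edge
  ; injective = λ {x} {y} eq → trans (sym (position-vertex x)) (trans (cong position eq) (position-vertex y))
  ; joins     = λ { {e} (inj₁ refl) → edge-joins e
                  ; {e} (inj₂ refl) → Sum.swap (edge-joins e) }
  }
  where
  vertex : Fin 4 → BookV n
  vertex 0F = u₁
  vertex 1F = u₂
  vertex 2F = v i
  vertex 3F = w i

  position : BookV n → Fin 4
  position u₁    = 0F
  position u₂    = 1F
  position (v _) = 2F
  position (w _) = 3F

  position-vertex : ∀ x → position (vertex x) ≡ x
  position-vertex 0F = refl
  position-vertex 1F = refl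
  position-vertex 2F = refl
  position-vertex 3F = refl

  edge : Fin 4 → BookE n
  edge 0F = u₁u₂
  edge 1F = u₂v i
  edge 2F = vw i
  edge 3F = u₁w i

  edge-joins : ∀ e → Joins (B n) (edge e) (vertex e) (vertex (next e))
  edge-joins 0F = inj₁ refl
  edge-joins 1F = inj₁ refl
  edge-joins 2F = inj₁ refl
  -- The closing side runs from `w i` to `u₁`, against the stored order of `u₁w i`.
  edge-joins 3F = inj₂ refl

module _ {m n : ℕ} where

  -- The spine lies on every page; a positive number of pages provides `page zero` to cover it.
  on-some-page : ∀ (e : E (m copiesOf B (suc n))) →
                 ∃ λ (φ : C 4 ↪ m copiesOf B (suc n)) → ∃ λ e′ → onE φ e′ ≡ e
  on-some-page (k , u₁u₂)  = copy-inclusion k ∘↪ page zero , 0F , refl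
  on-some-page (k , u₂v i) = copy-inclusion k ∘↪ page i , 1F , refl
  on-some-page (k , vw i)  = copy-inclusion k ∘↪ page i , 2F , refl
  on-some-page (k , u₁w i) = copy-inclusion k ∘↪ page i , 3F , refl

  -- Edges never leave a copy, so the whole cycle lies in the copy `k` of its first vertex. Within
  -- one copy, distinct vertices remain distinct after the copy number is dropped.
  weightAlong-4-cycle : ∀ (φ : C 4 ↪ m copiesOf B n) f g →
    ∃₂ λ k i → weightAlong φ f g ≡ total (pageTour (f ∘ (k ,_)) (g ∘ (k ,_)) i)
  weightAlong-4-cycle φ f g =
    let i , eq = 4-cycle-is-page (f ∘ (k ,_)) (g ∘ (k ,_))
                   (side 0F) (side 1F) (side 2F) (side 3F)
                   (distinct λ ()) (distinct λ ())
    in k , i , trans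
         (cong₂ _+_ (sumOver-cong (finite-Fin 4) λ j → cong (λ l → f (l , proj₂ (onV φ j))) (copyV j))
                    (sumOver-cong (finite-Fin 4) λ j → cong (λ l → g (l , proj₂ (onE φ j))) (copyE j)))
         eq
    where
    k : Fin m
    k = proj₁ (onV φ 0F)

    lowered : ∀ j → proj₁ (onV φ j) ≡ proj₁ (onE φ j) × proj₁ (onV φ (next j)) ≡ proj₁ (onE φ j)
            × Joins (B n) (proj₂ (onE φ j)) (proj₂ (onV φ j)) (proj₂ (onV φ (next j)))
    lowered j = lower {G = B n} (joins φ {j} {j} {next j} (inj₁ refl))

    side : ∀ j → Step (proj₂ (onE φ j)) (proj₂ (onV φ j)) (proj₂ (onV φ (next j)))
    side j = step _ (proj₂ (proj₂ (lowered j)))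

    advance : ∀ j → proj₁ (onV φ j) ≡ k → proj₁ (onV φ (next j)) ≡ k
    advance j eq = let here , there , _ = lowered j in trans there (trans (sym here) eq)

    copyV : ∀ j → proj₁ (onV φ j) ≡ k
    copyV 0F = refl
    copyV 1F = advance 0F refl
    copyV 2F = advance 1F (advance 0F refl)
    copyV 3F = advance 2F (advance 1F (advance 0F refl))

    copyE : ∀ j → proj₁ (onE φ j) ≡ k
    copyE j = trans (sym (proj₁ (lowered j))) (copyV j)

    distinct : ∀ {x y} → x ≢ y → proj₂ (onV φ x) ≢ proj₂ (onV φ y)
    distinct {x} {y} x≢y eq =
      x≢y (injective φ (cong₂ _,_ (trans (copyV x) (sym (copyV y))) eq))

-- A balanced ranking of the edges of one book.

toℕ-half : ∀ {a h} → Fin a ⊎ Fin h → ℕ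
toℕ-half = [ (λ j → 2 * toℕ j) , (λ j → suc (2 * toℕ j)) ]

-- Separates the even numbers 2j from the odd numbers 2j + 1.
halves : ∀ n → Fin n ↔ (Fin ⌈ n /2⌉ ⊎ Fin ⌊ n /2⌋)
halves zero    = mk↔ₛ′ (λ ()) [ (λ ()) , (λ ()) ] [ (λ ()) , (λ ()) ] (λ ())
halves (suc n) = mk↔ₛ′ there back there-back back-there
  where
  open Inverse (halves n)

  -- Adding one turns 2j into 2j + 1 and 2j + 1 into 2(j + 1). The types fit because `⌈ suc n /2⌉`
  -- computes to `suc ⌊ n /2⌋` and `⌊ suc n /2⌋` to `⌈ n /2⌉`.
  shift : Fin ⌈ n /2⌉ ⊎ Fin ⌊ n /2⌋ → Fin (suc ⌊ n /2⌋) ⊎ Fin ⌈ n /2⌉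
  shift (inj₁ j) = inj₂ j
  shift (inj₂ j) = inj₁ (suc j)

  there : Fin (suc n) → Fin (suc ⌊ n /2⌋) ⊎ Fin ⌈ n /2⌉
  there zero    = inj₁ zero
  there (suc i) = shift (to i)

  back : Fin (suc ⌊ n /2⌋) ⊎ Fin ⌈ n /2⌉ → Fin (suc n)
  back (inj₁ zero)    = zero
  back (inj₁ (suc j)) = suc (from (inj₂ j))
  back (inj₂ j)       = suc (from (inj₁ j))

  there-back : ∀ p → there (back p) ≡ p
  there-back (inj₁ zero)    = refl
  there-back (inj₁ (suc j)) = cong shift (strictlyInverseˡ (inj₂ j))
  there-back (inj₂ j)       = cong shift (strictlyInverseˡ (inj₁ j))

  back-shift : ∀ p → back (shift p) ≡ suc (from p)
  back-shift (inj₁ j) = refl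
  back-shift (inj₂ j) = refl

  back-there : ∀ i → back (there i) ≡ i
  back-there zero    = refl
  back-there (suc i) = trans (back-shift (to i)) (cong suc (strictlyInverseʳ i))

toℕ-halves : ∀ n p → toℕ (Inverse.from (halves n) p) ≡ toℕ-half p
toℕ-halves zero    (inj₁ ())
toℕ-halves zero    (inj₂ ())
toℕ-halves (suc n) (inj₁ zero)    = refl
toℕ-halves (suc n) (inj₁ (suc j)) =
  cong suc (trans (toℕ-halves n (inj₂ j)) (sym (+-suc (toℕ j) (toℕ j + 0))))
toℕ-halves (suc n) (inj₂ j)       = cong suc (toℕ-halves n (inj₁ j))

-- The alternatives are n even and n odd, which the successor exchanges.
⌈n/2⌉≡⌊n/2⌋∨1+⌊n/2⌋ : ∀ n → ⌈ n /2⌉ ≡ ⌊ n /2⌋ ⊎ ⌈ n /2⌉ ≡ suc ⌊ n /2⌋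
⌈n/2⌉≡⌊n/2⌋∨1+⌊n/2⌋ zero    = inj₁ refl
⌈n/2⌉≡⌊n/2⌋∨1+⌊n/2⌋ (suc n) =
  Sum.swap (Sum.map (λ eq → cong suc (sym eq)) sym (⌈n/2⌉≡⌊n/2⌋∨1+⌊n/2⌋ n))

-- The slope 2 matches the vertices: the ranks of `v i` and `w i` each grow by one per page.
Balanced : ∀ {n} → Finite (BookE n) → ℕ → Set
Balanced {n} F r = ∀ i →
  rank F u₁u₂ + rank F (u₁w i) + rank F (u₂v i) + rank F (vw i) ≡ r + 2 * toℕ i

-- The summands are the spine, `u₁w`, `u₂v` and `vw`. The middle two, ranked by α and β, are split
-- by the parity of the page.
Blocks : ℕ → ℕ → ℕ → Set
Blocks n a h = Fin 1 ⊎ ((Fin a ⊎ Fin h) ⊎ ((Fin a ⊎ Fin h) ⊎ Fin n))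

blocks : ∀ {n a h} → Fin n ↔ (Fin a ⊎ Fin h) → BookE n ↔ Blocks n a h
blocks π = ↔-trans
  (mk↔ₛ′
    (λ { u₁u₂ → inj₁ 0F ; (u₁w i) → inj₂ (inj₁ i)
       ; (u₂v i) → inj₂ (inj₂ (inj₁ i)) ; (vw i) → inj₂ (inj₂ (inj₂ i)) })
    (λ { (inj₁ 0F) → u₁u₂ ; (inj₂ (inj₁ i)) → u₁w i
       ; (inj₂ (inj₂ (inj₁ i))) → u₂v i ; (inj₂ (inj₂ (inj₂ i))) → vw i })
    (λ { (inj₁ 0F) → refl ; (inj₂ (inj₁ i)) → refl
       ; (inj₂ (inj₂ (inj₁ i))) → refl ; (inj₂ (inj₂ (inj₂ i))) → refl })
    (λ { u₁u₂ → refl ; (u₁w i) → refl ; (u₂v i) → refl ; (vw i) → refl }))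
  (↔-refl ⊎-↔ (π ⊎-↔ (π ⊎-↔ ↔-refl)))

module _ {n a h} (L : Finite (Blocks n a h)) where

  -- The page enters as `p` in the split blocks and as `i` in the unsplit one; the layout lemmas tie
  -- the two by `toℕ i ≡ toℕ-half p`.
  columnSum : Fin a ⊎ Fin h → Fin n → ℕ
  columnSum p i = rank L (inj₁ 0F) + rank L (inj₂ (inj₁ p))
                + rank L (inj₂ (inj₂ (inj₁ p))) + rank L (inj₂ (inj₂ (inj₂ i)))

  columnSum-≡ : ∀ p i {s x y z} →
    rank L (inj₁ 0F) ≡ s → rank L (inj₂ (inj₁ p)) ≡ x →
    rank L (inj₂ (inj₂ (inj₁ p))) ≡ y → rank L (inj₂ (inj₂ (inj₂ i))) ≡ z →
    columnSum p i ≡ s + x + y + z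
  columnSum-≡ p i refl refl refl refl = refl

module _ (n h : ℕ) where
  private
    single  = finite-Fin 1
    half    = finite-Fin h
    mid     = finite-⊎ single half
    left    = finite-⊎ half mid
    crossed = finite-⊎ half half
    right   = finite-⊎ crossed (finite-Fin n)

  -- The order is α (even pages), spine, α (odd), β (odd), β (even), vw.
  evenLayout : Finite (Blocks n h h)
  evenLayout = transport
    (mk↔ₛ′
      (λ { (inj₁ z) → inj₁ (inj₂ (inj₁ z))
         ; (inj₂ (inj₁ (inj₁ j))) → inj₁ (inj₁ j)
         ; (inj₂ (inj₁ (inj₂ j))) → inj₁ (inj₂ (inj₂ j))
         ; (inj₂ (inj₂ (inj₁ p))) → inj₂ (inj₁ (Sum.swap p))
         ; (inj₂ (inj₂ (inj₂ i))) → inj₂ (inj₂ i) })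
      (λ { (inj₁ (inj₂ (inj₁ z))) → inj₁ z
         ; (inj₁ (inj₁ j)) → inj₂ (inj₁ (inj₁ j))
         ; (inj₁ (inj₂ (inj₂ j))) → inj₂ (inj₁ (inj₂ j))
         ; (inj₂ (inj₁ p)) → inj₂ (inj₂ (inj₁ (Sum.swap p)))
         ; (inj₂ (inj₂ i)) → inj₂ (inj₂ (inj₂ i)) })
      (λ { (inj₁ (inj₂ (inj₁ z))) → refl ; (inj₁ (inj₁ j)) → refl
         ; (inj₁ (inj₂ (inj₂ j))) → refl ; (inj₂ (inj₁ (inj₁ j))) → refl
         ; (inj₂ (inj₁ (inj₂ j))) → refl ; (inj₂ (inj₂ i)) → refl })
      (λ { (inj₁ z) → refl ; (inj₂ (inj₁ (inj₁ j))) → refl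
         ; (inj₂ (inj₁ (inj₂ j))) → refl ; (inj₂ (inj₂ (inj₁ (inj₁ j)))) → refl
         ; (inj₂ (inj₂ (inj₁ (inj₂ j)))) → refl ; (inj₂ (inj₂ (inj₂ i))) → refl }))
    (finite-⊎ left right)

  -- Here b = 3h + 1, c = h + 1 and d = 2h + 1, so α + β = 3h + 1 + i on both parities. The spine
  -- adds h and `vw` adds 4h + 1 + i.
  columnSum-even : ∀ p i → toℕ i ≡ toℕ-half p →
                   columnSum evenLayout p i ≡ 8 * h + 2 + 2 * toℕ-half p
  columnSum-even p i eq = trans
    (columnSum-≡ evenLayout p i
      (rank-inj₁ left right (inj₂ (inj₁ 0F))
        (rank-inj₂ half mid (inj₁ 0F) (rank-inj₁ single half 0F refl)))
      (first p) (second p)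
      (rank-inj₂ left right (inj₂ i) (rank-inj₂ crossed (finite-Fin n) i eq)))
    (arith p)
    where
    α β : Fin h ⊎ Fin h → ℕ
    α = [ toℕ , (λ j → h + (1 + toℕ j)) ]
    β = [ (λ j → (h + (1 + h)) + (h + toℕ j)) , (λ j → (h + (1 + h)) + toℕ j) ]

    first : ∀ p → rank evenLayout (inj₂ (inj₁ p)) ≡ α p
    first (inj₁ j) = rank-inj₁ left right (inj₁ j) (rank-inj₁ half mid j refl)
    first (inj₂ j) = rank-inj₁ left right (inj₂ (inj₂ j))
      (rank-inj₂ half mid (inj₂ j) (rank-inj₂ single half j refl))

    second : ∀ p → rank evenLayout (inj₂ (inj₂ (inj₁ p))) ≡ β p
    second (inj₁ j) = rank-inj₂ left right (inj₁ (inj₂ j))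
      (rank-inj₁ crossed (finite-Fin n) (inj₂ j) (rank-inj₂ half half j refl))
    second (inj₂ j) = rank-inj₂ left right (inj₁ (inj₁ j))
      (rank-inj₁ crossed (finite-Fin n) (inj₁ j) (rank-inj₁ half half j refl))

    arith : ∀ p → (h + 0) + α p + β p + ((h + (1 + h)) + ((h + h) + toℕ-half p))
                  ≡ 8 * h + 2 + 2 * toℕ-half p
    arith (inj₁ j) = solved h (toℕ j)
      where
      solved : ∀ h j → (h + 0) + j + ((h + (1 + h)) + (h + j)) + ((h + (1 + h)) + ((h + h) + 2 * j))
                       ≡ 8 * h + 2 + 2 * (2 * j)
      solved = solve-∀
    arith (inj₂ j) = solved h (toℕ j)
      where
      solved : ∀ h j → (h + 0) + (h + (1 + j)) + ((h + (1 + h)) + j)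
                         + ((h + (1 + h)) + ((h + h) + (1 + 2 * j)))
                       ≡ 8 * h + 2 + 2 * (1 + 2 * j)
      solved = solve-∀

module _ (n h : ℕ) where
  private
    a       = suc h
    single  = finite-Fin 1
    direct  = finite-⊎ (finite-Fin a) (finite-Fin h)
    crossed = finite-⊎ (finite-Fin h) (finite-Fin a)
    inner   = finite-⊎ crossed (finite-Fin n)
    outer   = finite-⊎ direct inner

  -- The order is spine, α (even pages), α (odd), β (odd), β (even), vw.
  oddLayout : Finite (Blocks n a h)
  oddLayout = transport
    (↔-refl ⊎-↔ (↔-refl ⊎-↔ (mk↔ₛ′ Sum.swap Sum.swap swap-involutive swap-involutive ⊎-↔ ↔-refl)))
    (finite-⊎ single outer)

  -- The values of b, c, d are those of the even case, but the leading spine of rank 0 shifts α and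
  -- β by one each: α + β = 3h + 3 + i, and `vw` adds 4h + 3 + i.
  columnSum-odd : ∀ p i → toℕ i ≡ toℕ-half p →
                  columnSum oddLayout p i ≡ 7 * h + 6 + 2 * toℕ-half p
  columnSum-odd p i eq = trans
    (columnSum-≡ oddLayout p i
      (rank-inj₁ single outer 0F refl) (first p) (second p)
      (rank-inj₂ single outer (inj₂ (inj₂ i))
        (rank-inj₂ direct inner (inj₂ i) (rank-inj₂ crossed (finite-Fin n) i eq))))
    (arith p)
    where
    α β : Fin a ⊎ Fin h → ℕ
    α = [ (λ j → 1 + toℕ j) , (λ j → 1 + (a + toℕ j)) ]
    β = [ (λ j → 1 + ((a + h) + (h + toℕ j))) , (λ j → 1 + ((a + h) + toℕ j)) ]

    first : ∀ p → rank oddLayout (inj₂ (inj₁ p)) ≡ α p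
    first (inj₁ j) = rank-inj₂ single outer (inj₁ (inj₁ j))
      (rank-inj₁ direct inner (inj₁ j) (rank-inj₁ (finite-Fin a) (finite-Fin h) j refl))
    first (inj₂ j) = rank-inj₂ single outer (inj₁ (inj₂ j))
      (rank-inj₁ direct inner (inj₂ j) (rank-inj₂ (finite-Fin a) (finite-Fin h) j refl))

    second : ∀ p → rank oddLayout (inj₂ (inj₂ (inj₁ p))) ≡ β p
    second (inj₁ j) = rank-inj₂ single outer (inj₂ (inj₁ (inj₂ j)))
      (rank-inj₂ direct inner (inj₁ (inj₂ j))
        (rank-inj₁ crossed (finite-Fin n) (inj₂ j) (rank-inj₂ (finite-Fin h) (finite-Fin a) j refl)))
    second (inj₂ j) = rank-inj₂ single outer (inj₂ (inj₁ (inj₁ j)))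
      (rank-inj₂ direct inner (inj₁ (inj₁ j))
        (rank-inj₁ crossed (finite-Fin n) (inj₁ j) (rank-inj₁ (finite-Fin h) (finite-Fin a) j refl)))

    arith : ∀ p → 0 + α p + β p + (1 + ((a + h) + ((h + a) + toℕ-half p)))
                  ≡ 7 * h + 6 + 2 * toℕ-half p
    arith (inj₁ j) = solved h (toℕ j)
      where
      solved : ∀ h j → 0 + (1 + j) + (1 + ((1 + h + h) + (h + j)))
                         + (1 + ((1 + h + h) + ((h + (1 + h)) + 2 * j)))
                       ≡ 7 * h + 6 + 2 * (2 * j)
      solved = solve-∀
    arith (inj₂ j) = solved h (toℕ j)
      where
      solved : ∀ h j → 0 + (1 + (1 + h + j)) + (1 + ((1 + h + h) + j))
                         + (1 + ((1 + h + h) + ((h + (1 + h)) + (1 + 2 * j))))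
                       ≡ 7 * h + 6 + 2 * (1 + 2 * j)
      solved = solve-∀

-- The block sizes are variables so that the parity equation can be matched with `refl`.
balancedLayout : ∀ n a h → a ≡ h ⊎ a ≡ suc h →
  ∃₂ λ (L : Finite (Blocks n a h)) r → ∀ p i → toℕ i ≡ toℕ-half p →
  columnSum L p i ≡ r + 2 * toℕ-half p
balancedLayout n a h (inj₁ refl) = evenLayout n h , 8 * h + 2 , columnSum-even n h
balancedLayout n a h (inj₂ refl) = oddLayout n h , 7 * h + 6 , columnSum-odd n h

balancedRanking : ∀ n → ∃₂ λ (F : Finite (BookE n)) r → Balanced F r
balancedRanking n =
  let L , r , columnSum≡ = balancedLayout n ⌈ n /2⌉ ⌊ n /2⌋ (⌈n/2⌉≡⌊n/2⌋∨1+⌊n/2⌋ n)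
  in transport (blocks (halves n)) L , r , λ i →
       let eq = trans (cong toℕ (sym (strictlyInverseʳ i))) (toℕ-halves n (to i))
       in trans (columnSum≡ (to i) i eq) (cong (λ x → r + 2 * x) (sym eq))
  where open Inverse (halves n)

-- The labeling of the m copies and its constant page sum.

module _ (m n : ℕ) where
  private
    G = m copiesOf B n
    ranking = balancedRanking n
    FE = proj₁ ranking
    r  = proj₁ (proj₂ ranking)

  -- Swapping the factors makes the copy number the low-order digit, as the rank m ρ + k requires.
  copywise : ∀ {A} → Finite A → Finite (Fin m × A)
  copywise F = transport (mk↔ₛ′ swap swap (λ _ → refl) (λ _ → refl)) (finite-× F (finite-Fin m))

  rank-copywise : ∀ {A} (F : Finite A) k x → rank (copywise F) (k , x) ≡ m * rank F x + toℕ k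
  rank-copywise F k x = rank-× F (finite-Fin m) x k

  vertexRanking : Finite (V G)
  vertexRanking = copywise (finite-BookV n)

  edgeRanking : Finite (E G)
  edgeRanking = reversed (copywise FE)

  vertexLabel : V G → ℕ
  vertexLabel x = suc (rank vertexRanking x)

  edgeLabel : E G → ℕ
  edgeLabel e = suc (∣V∣ G + rank edgeRanking e)

  top : ℕ
  top = ∣V∣ G + card edgeRanking

  pageSum : Fin m → Fin n → ℕ
  pageSum k i = total (pageTour (vertexLabel ∘ (k ,_)) (edgeLabel ∘ (k ,_)) i)

  -- Reversal makes the label of an edge complementary to its unreversed rank m ρ + k.
  edgeLabel-≡ : ∀ k e → edgeLabel (k , e) + (m * rank FE e + toℕ k) ≡ top
  edgeLabel-≡ k e = trans
    (regroup (∣V∣ G) (rank edgeRanking (k , e)) (m * rank FE e + toℕ k))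
    (cong (∣V∣ G +_) (trans
      (cong (λ x → rank edgeRanking (k , e) + suc x) (sym (rank-copywise FE k e)))
      (rank-reversed (copywise FE) (k , e))))
    where
    regroup : ∀ a b c → (1 + (a + b)) + c ≡ a + (b + (1 + c))
    regroup = solve-∀

  bookV-ranks : ∀ i → rank (finite-BookV n) (v i) ≡ 2 + toℕ i
                    × rank (finite-BookV n) (w i) ≡ 2 + (n + toℕ i)
  bookV-ranks i =
    rank-inj₂ (finite-Fin 2) pages (inj₁ i) (rank-inj₁ (finite-Fin n) (finite-Fin n) i refl) ,
    rank-inj₂ (finite-Fin 2) pages (inj₂ i) (rank-inj₂ (finite-Fin n) (finite-Fin n) i refl)
    where pages = finite-⊎ (finite-Fin n) (finite-Fin n)

  -- The subtraction does not truncate: the proof shows that pageSum k i + m * r is the minuend.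
  pageSum-constant : ∀ k i → pageSum k i ≡ 4 * top + 4 + m * (5 + n) ∸ m * r
  pageSum-constant k i = trans (sym (m+n∸n≡m (pageSum k i) (m * r)))
    (cong (_∸ m * r) (trans
      (cong (λ x → x + (p + (q + (s + (t + 0)))) + m * r) vertices)
      -- The added term is the part of the vertex sum that varies with page and copy. Together with
      -- `m * r` it completes the four edge labels to four times `top`.
      (+-cancelʳ-≡ (m * (2 * toℕ i) + 4 * toℕ k) _ _ (begin
        Σv + (p + (q + (s + (t + 0)))) + m * r + (m * (2 * toℕ i) + 4 * toℕ k)
          ≡⟨ gather m (toℕ k) (toℕ i) r Σv p q s t ⟩
        Σv + (p + (q + (s + (t + 0)))) + (m * (r + 2 * toℕ i) + 4 * toℕ k)
          ≡⟨ cong (λ x → Σv + (p + (q + (s + (t + 0)))) + (m * x + 4 * toℕ k))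
                 (proj₂ (proj₂ ranking) i) ⟨
        Σv + (p + (q + (s + (t + 0)))) + (m * (ρ u₁u₂ + ρ (u₁w i) + ρ (u₂v i) + ρ (vw i)) + 4 * toℕ k)
          ≡⟨ distribute m (toℕ k) Σv p q s t (ρ u₁u₂) (ρ (u₁w i)) (ρ (u₂v i)) (ρ (vw i)) ⟩
        Σv + ((p + (m * ρ u₁u₂ + toℕ k)) + (q + (m * ρ (u₂v i) + toℕ k))
          + ((s + (m * ρ (vw i) + toℕ k)) + (t + (m * ρ (u₁w i) + toℕ k))))
          ≡⟨ cong (Σv +_) (cong₂ _+_ (cong₂ _+_ (edgeLabel-≡ k u₁u₂) (edgeLabel-≡ k (u₂v i)))
                                    (cong₂ _+_ (edgeLabel-≡ k (vw i)) (edgeLabel-≡ k (u₁w i)))) ⟩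
        Σv + (top + top + (top + top))
          -- The vertex ranks 0, 1, 2 + i and 2 + n + i add up to 5 + n + 2i, whence the term m (5 +
          -- n).
          ≡⟨ evaluate m n (toℕ k) (toℕ i) top ⟩
        4 * top + 4 + m * (5 + n) + (m * (2 * toℕ i) + 4 * toℕ k) ∎))))
    where
    open ≡-Reasoning

    ρ : BookE n → ℕ
    ρ = rank FE

    p = edgeLabel (k , u₁u₂)
    q = edgeLabel (k , u₂v i)
    s = edgeLabel (k , vw i)
    t = edgeLabel (k , u₁w i)

    Σv : ℕ
    Σv = suc (m * 0 + toℕ k) + (suc (m * 1 + toℕ k)
      + (suc (m * (2 + toℕ i) + toℕ k) + (suc (m * (2 + (n + toℕ i)) + toℕ k) + 0)))

    vertexLabel-≡ : ∀ x {y} → rank (finite-BookV n) x ≡ y →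
                    vertexLabel (k , x) ≡ suc (m * y + toℕ k)
    vertexLabel-≡ x refl = cong suc (rank-copywise (finite-BookV n) k x)

    vertices : vertexLabel (k , u₁) + (vertexLabel (k , u₂)
             + (vertexLabel (k , v i) + (vertexLabel (k , w i) + 0))) ≡ Σv
    vertices = cong₂ _+_ (vertexLabel-≡ u₁ refl) (cong₂ _+_ (vertexLabel-≡ u₂ refl)
      (cong₂ _+_ (vertexLabel-≡ (v i) (proj₁ (bookV-ranks i)))
        (cong (_+ 0) (vertexLabel-≡ (w i) (proj₂ (bookV-ranks i))))))

    gather : ∀ m k i r Σv p q s t →
      Σv + (p + (q + (s + (t + 0)))) + m * r + (m * (2 * i) + 4 * k)
        ≡ Σv + (p + (q + (s + (t + 0)))) + (m * (r + 2 * i) + 4 * k)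
    gather = solve-∀

    distribute : ∀ m k Σv p q s t a b c d →
      Σv + (p + (q + (s + (t + 0)))) + (m * (a + b + c + d) + 4 * k)
        ≡ Σv + ((p + (m * a + k)) + (q + (m * c + k)) + ((s + (m * d + k)) + (t + (m * b + k))))
    distribute = solve-∀

    evaluate : ∀ m n k i T →
      (1 + (m * 0 + k)) + ((1 + (m * 1 + k))
        + ((1 + (m * (2 + i) + k)) + ((1 + (m * (2 + (n + i)) + k)) + 0))) + (T + T + (T + T))
        ≡ 4 * T + 4 + m * (5 + n) + (m * (2 * i) + 4 * k)
    evaluate = solve-∀

theorem7 : ∀ (m n : ℕ) → 2 ≤ m → 2 ≤ n → C 4 -Supermagic (m copiesOf B n)
theorem7 m (suc n) _ _ =
  supermagic-from-ranks (vertexRanking m (suc n)) (edgeRanking m (suc n)) on-some-page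
    λ φ → let k , i , eq = weightAlong-4-cycle φ (vertexLabel m (suc n)) (edgeLabel m (suc n))
          in trans eq (pageSum-constant m (suc n) k i)
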